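{- For any positive integers $n$ and $k$, $$ f(n,k,0) \le \frac{n}{k} \left\lfloor \frac{k^2}{4} \right\rfloor + n + 1. $$
   Context: Let $[n]=\{1,\dots,n\}$. For non-negative integers $k,\lambda$, a family (set of distinct subsets) $\mathcal{F}\subset 2^{[n]}$ is called $k$-almost $\lambda$-Fisher if for every $F\in\mathcal{F}$ there are at most $k$ other sets $F'\in\mathcal{F}\setminus\{F\}$ with $|F\cap F'|\neq\lambda$. Define $f(n,k,\lambda)=\max\{|\mathcal{F}| : \mathcal{F}\subset 2^{[n]} \text{ is a } k\text{ -almost } \lambda\text{ -Fisher family}\}$. The empty set is allowed as a member of $\mathcal{F}$. -}

module Defs where

open import Data.Bool using () renaming (_≟_ to _≟ᵇ_)
open import Data.Fin.Subset using (Subset; inside; outside; _∩_; ∣_∣)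
open import Data.List using (List; []; _∷_; _++_; map; filter; length)
open import Data.List.Extrema.Nat using (max; argmax-sel; xs≤max)
open import Data.List.Membership.Propositional using (_∈_)
open import Data.List.Membership.Propositional.Properties using (∈-++⁺ˡ; ∈-++⁺ʳ; ∈-++⁻; ∈-map⁺; ∈-map⁻; ∈-filter⁺; ∈-filter⁻)
open import Data.List.Membership.Propositional.Properties.WithK using (unique∧set⇒bag)
open import Data.List.Relation.Binary.BagAndSetEquality using (∼bag⇒↭)
open import Data.List.Relation.Binary.Permutation.Propositional using (_↭_)
open import Data.List.Relation.Binary.Permutation.Propositional.Properties using (filter-↭; ↭-length; All-resp-↭)
open import Data.List.Relation.Binary.Disjoint.Propositional using (Disjoint)
open import Data.List.Relation.Unary.All as All using (All; []; _∷_; all?)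
open import Data.List.Relation.Unary.AllPairs using ([]; _∷_; allPairs?)
open import Data.List.Relation.Unary.Any using (here)
open import Data.List.Relation.Unary.Unique.Propositional using (Unique)
import Data.List.Relation.Unary.Unique.Propositional.Properties as Unique
open import Data.Nat using (ℕ; zero; suc; _≤_; z≤n)
import Data.Nat.Properties as ℕ
open import Data.Product using (_×_; _,_; proj₁; proj₂; ∃-syntax)
open import Data.Sum using (inj₁; inj₂)
open import Data.Vec using ([]; _∷_)
open import Data.Vec.Properties using (≡-dec; ∷-injectiveʳ)
open import Function.Bundles using (mk⇔)
open import Relation.Binary.Definitions using (DecidableEquality)
open import Relation.Binary.PropositionalEquality using (_≡_; _≢_; refl; sym; subst)
open import Relation.Nullary using (yes; no; ¬?; _×-dec_)
open import Relation.Unary using (Decidable)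

private
  variable
    n : ℕ

_≟ˢ_ : DecidableEquality (Subset n)
_≟ˢ_ = ≡-dec _≟ᵇ_

-- [n] is modelled by Fin n, and a family of subsets of [n] by a
-- duplicate-free list of subsets.

Exceptional : ℕ → Subset n → Subset n → Set
Exceptional ℓ F F′ = F′ ≢ F × ∣ F ∩ F′ ∣ ≢ ℓ

exceptional? : ∀ ℓ (F : Subset n) → Decidable (Exceptional ℓ F)
exceptional? ℓ F F′ = ¬? (F′ ≟ˢ F) ×-dec ¬? (∣ F ∩ F′ ∣ ℕ.≟ ℓ)

AlmostFisher : (k ℓ : ℕ) → List (Subset n) → Set
AlmostFisher k ℓ 𝓕 =
  Unique 𝓕 × All (λ F → length (filter (exceptional? ℓ F) 𝓕) ≤ k) 𝓕

almostFisher? : ∀ k ℓ → Decidable (AlmostFisher {n} k ℓ)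
almostFisher? k ℓ 𝓕 =
  allPairs? (λ F F′ → ¬? (F ≟ˢ F′)) 𝓕 ×-dec
  all? (λ F → length (filter (exceptional? ℓ F) 𝓕) ℕ.≤? k) 𝓕

allSubsets : ∀ n → List (Subset n)
allSubsets zero    = [] ∷ []
allSubsets (suc n) = map (outside ∷_) (allSubsets n) ++ map (inside ∷_) (allSubsets n)

sublists : {A : Set} → List A → List (List A)
sublists []       = [] ∷ []
sublists (x ∷ xs) = sublists xs ++ map (x ∷_) (sublists xs)

-- The lists in sublists (allSubsets n) represent each family of subsets
-- of [n] exactly once; f-attained and f-upper below show that f is the
-- maximum over all families.

f : (n k ℓ : ℕ) → ℕ
f n k ℓ = max 0 (map length (filter (almostFisher? k ℓ) (sublists (allSubsets n))))

f-attained : ∀ n k ℓ → ∃[ 𝓕 ] AlmostFisher {n} k ℓ 𝓕 × length 𝓕 ≡ f n k ℓ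
f-attained n k ℓ
  with argmax-sel (λ m → m) 0 (map length (filter (almostFisher? k ℓ) (sublists (allSubsets n))))
... | inj₁ f≡0 = [] , ([] , []) , sym f≡0
... | inj₂ f∈ with ∈-map⁻ length f∈
...   | 𝓕 , 𝓕∈ , f≡ = 𝓕 , proj₂ (∈-filter⁻ (almostFisher? k ℓ) {xs = sublists (allSubsets n)} 𝓕∈) , sym f≡

∈-allSubsets : (F : Subset n) → F ∈ allSubsets n
∈-allSubsets []            = here refl
∈-allSubsets (outside ∷ F) = ∈-++⁺ˡ (∈-map⁺ (outside ∷_) (∈-allSubsets F))
∈-allSubsets (inside  ∷ F) = ∈-++⁺ʳ (map (outside ∷_) (allSubsets _)) (∈-map⁺ (inside ∷_) (∈-allSubsets F))

allSubsets-unique : ∀ n → Unique (allSubsets n)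
allSubsets-unique zero    = [] ∷ []
allSubsets-unique (suc n) = Unique.++⁺
  (Unique.map⁺ ∷-injectiveʳ (allSubsets-unique n))
  (Unique.map⁺ ∷-injectiveʳ (allSubsets-unique n))
  disjoint
  where
  disjoint : Disjoint (map (outside ∷_) (allSubsets n)) (map (inside ∷_) (allSubsets n))
  disjoint (F∈o , F∈i) with ∈-map⁻ (outside ∷_) F∈o | ∈-map⁻ (inside ∷_) F∈i
  ... | _ , _ , refl | _ , _ , ()

filter∈sublists : {A : Set} {P : A → Set} (P? : Decidable P) (xs : List A) →
                  filter P? xs ∈ sublists xs
filter∈sublists P? []       = here refl
filter∈sublists P? (x ∷ xs) with P? x
... | yes _ = ∈-++⁺ʳ (sublists xs) (∈-map⁺ (x ∷_) (filter∈sublists P? xs))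
... | no  _ = ∈-++⁺ˡ (filter∈sublists P? xs)

AlmostFisher-resp-↭ : ∀ {k ℓ} {𝓕 𝓖 : List (Subset n)} → 𝓕 ↭ 𝓖 → Unique 𝓖 →
                      AlmostFisher k ℓ 𝓕 → AlmostFisher k ℓ 𝓖
AlmostFisher-resp-↭ {k = k} {ℓ} 𝓕↭𝓖 𝓖! (_ , 𝓕≤k) =
  𝓖! , All.map (λ {F} → subst (_≤ k) (↭-length (filter-↭ (exceptional? ℓ F) 𝓕↭𝓖)))
               (All-resp-↭ 𝓕↭𝓖 𝓕≤k)

f-upper : ∀ {n k ℓ} (𝓕 : List (Subset n)) → AlmostFisher k ℓ 𝓕 → length 𝓕 ≤ f n k ℓ
f-upper {n} {k} {ℓ} 𝓕 𝓕-fisher@(𝓕! , _) =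
  subst (_≤ f n k ℓ) (sym (↭-length 𝓕↭𝓖)) (All.lookup (xs≤max 0 _)
    (∈-map⁺ length (∈-filter⁺ (almostFisher? k ℓ) (filter∈sublists (_∈? 𝓕) (allSubsets n))
      (AlmostFisher-resp-↭ 𝓕↭𝓖 𝓖! 𝓕-fisher))))
  where
  open import Data.List.Membership.DecPropositional (_≟ˢ_ {n}) using (_∈?_)
  𝓖 = filter (_∈? 𝓕) (allSubsets n)
  𝓖! : Unique 𝓖
  𝓖! = Unique.filter⁺ (_∈? 𝓕) (allSubsets-unique n)
  𝓕↭𝓖 : 𝓕 ↭ 𝓖
  𝓕↭𝓖 = ∼bag⇒↭ (unique∧set⇒bag 𝓕! 𝓖! (mk⇔
    (λ F∈𝓕 → ∈-filter⁺ (_∈? 𝓕) (∈-allSubsets _) F∈𝓕)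
    (λ F∈𝓖 → proj₂ (∈-filter⁻ (_∈? 𝓕) {xs = allSubsets n} F∈𝓖))))

{-# OPTIONS --safe #-}
module Submission where

-- A member of the family is a vertex of the graph that joins two members
-- when they meet; every degree in this graph is at most k.  Replacing a
-- member F by an absent singleton ⁅ x ⁆ with x in F destroys intersections
-- and creates none, so every point covered by the family may be assumed to
-- be a singleton member (saturate).
--
-- For such a family let a(x) be the number of members containing x, let
-- b(x) = max(a(x) - 1, 0), and write q for the integer part of k²/4 and W
-- for the sum of max(|F| - 1, 0) over the members F.  Then the sum of b² is
-- at most k W.  Indeed the sum of a² is the sum of |F ∩ G| over all ordered
-- pairs of members.  If F and G are distinct and meet, then 2 |F ∩ G| is at
-- most (|F| - 1) + (|G| - 1), unless one of them, say F, is obtained from G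
-- by deleting a single point, and then it exceeds that number by one.  Each
-- F pays |F| - 1 for at most k other members.  The diagonal terms add up to
-- the sum of a.  The exceptional pairs number at most the sum of b, because
-- a pair (G - x, G) with G - x nonempty is determined by x and by a member
-- G containing x other than ⁅ x ⁆, and ⁅ x ⁆ itself is a member
-- (∑-degree²≤).  Since a² = b² + b + a, the claim follows (∑-b²≤).
--
-- For natural numbers b one has k b ≤ b² + q.  Summing over the points
-- bounds k times the sum of b by k W + n q.  The sum of b is at least the
-- sum of a less n, the sum of a is the sum of the |F|, and the latter is at
-- least W plus the number of nonempty members.  Hence k (|𝓕| - 1) is at
-- most n q + k n (saturated-bound), the 1 accounting for the empty set.

open import Defs

open import Data.Bool using (if_then_else_)
open import Data.Fin using (Fin; zero; suc)
import Data.Fin.Properties as Fin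
open import Data.Fin.Subset using (Subset; inside; outside; ⊥; ⁅_⁆; _∩_; ∣_∣; _-_; _⊆_; _⊂_; Nonempty)
  renaming (_∈_ to _∈ˢ_)
open import Data.Fin.Subset.Properties
  using (_∈?_; ⊆-antisym; nonempty?; Empty-unique; ∣⊥∣≡0; x∈⁅x⁆; x∈⁅y⁆⇒x≡y; x∈p∩q⁺; x∈p∩q⁻;
         p∩q⊆p; p∩q⊆q; ∩-comm; ∩-idem; p⊂q⇒∣p∣<∣q∣; x∈p⇒∣p-x∣<∣p∣; x∈p∧x≢y⇒x∈p-y)
import Data.Integer as ℤ
import Data.Integer.Properties as ℤ
open import Data.List using (List; []; _∷_; map; filter; length; allFin; tabulate)
import Data.List.Membership.DecPropositional as DecMembership
open import Data.List.Membership.Propositional using (_∈_; _∉_; find; lose)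
open import Data.List.Membership.Propositional.Properties using (∈-∃++; ∈-allFin)
open import Data.List.Properties using (map-tabulate; map-∘; length-tabulate)
open import Data.List.Relation.Binary.Permutation.Propositional using (_↭_; ↭-reflexive; ↭-sym; ↭-trans; ↭⇒↭ₛ)
open import Data.List.Relation.Binary.Permutation.Propositional.Properties using (shift; ↭-length; map⁺; ∈-resp-↭)
import Data.List.Relation.Binary.Permutation.Setoid.Properties as ↭ₛ
open import Data.List.Relation.Unary.All as All using (All; []; _∷_)
open import Data.List.Relation.Unary.All.Properties using (¬Any⇒All¬)
open import Data.List.Relation.Unary.AllPairs using ([]; _∷_)
open import Data.List.Relation.Unary.Any using (here; there; any?)
open import Data.List.Relation.Unary.Unique.Propositional using (Unique)
open import Data.Nat using (ℕ; zero; suc; NonZero; _∸_; _^_; z≤n; s≤s) renaming (_/_ to _div_)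
open import Data.Nat.DivMod using (/-monoˡ-≤; m*n/n≡m)
open import Data.Nat.Induction using (<-wellFounded)
open import Data.Nat.ListAction using (sum)
open import Data.Nat.ListAction.Properties using (sum-↭)
import Data.Nat.Properties as ℕ
open import Data.Nat.Tactic.RingSolver using (solve-∀)
open import Data.Product using (_×_; _,_; proj₁; proj₂; ∃-syntax)
import Data.Rational.Properties as ℚ
open import Data.Rational.Unnormalised as ℚᵘ using (mkℚᵘ; 1ℚᵘ)
import Data.Rational.Unnormalised.Properties as ℚᵘ
open import Data.Sum using (_⊎_; inj₁; inj₂)
open import Data.Vec using ([]; _∷_)
open import Function using (_∘_)
open import Induction.WellFounded using (Acc; acc)
open import Relation.Binary.PropositionalEquality
  using (_≡_; _≢_; refl; sym; trans; cong; cong₂; subst; subst₂; setoid; module ≡-Reasoning)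
open import Relation.Nullary using (Dec; yes; no; does; ¬_; ¬?; _×-dec_; contradiction)
open import Relation.Unary using (Decidable)

private
  variable
    A B : Set
    n : ℕ

-- The combinatorial argument takes place over the natural numbers; in this
-- module + * ≤ < refer to them.
module Counting where

  open Data.Nat using (_+_; _*_; _≤_; _<_)

  -- Finite sums over lists

  -- The sum of g over the entries of xs, counted with multiplicity.
  ∑ : List A → (A → ℕ) → ℕ
  ∑ xs g = sum (map g xs)

  ∑-cong : ∀ (xs : List A) {g h : A → ℕ} → (∀ x → g x ≡ h x) → ∑ xs g ≡ ∑ xs h
  ∑-cong []       eq = refl
  ∑-cong (x ∷ xs) eq = cong₂ _+_ (eq x) (∑-cong xs eq)

  ∑-mono : {xs : List A} {g h : A → ℕ} → All (λ x → g x ≤ h x) xs → ∑ xs g ≤ ∑ xs h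
  ∑-mono []       = z≤n
  ∑-mono (p ∷ ps) = ℕ.+-mono-≤ p (∑-mono ps)

  ∑-mono′ : ∀ (xs : List A) {g h : A → ℕ} → (∀ x → g x ≤ h x) → ∑ xs g ≤ ∑ xs h
  ∑-mono′ xs g≤h = ∑-mono (All.universal g≤h xs)

  ∑-const : ∀ (xs : List A) c → ∑ xs (λ _ → c) ≡ length xs * c
  ∑-const []       c = refl
  ∑-const (x ∷ xs) c = cong (c +_) (∑-const xs c)

  ∑-+ : ∀ (xs : List A) (g h : A → ℕ) → ∑ xs (λ x → g x + h x) ≡ ∑ xs g + ∑ xs h
  ∑-+ []       g h = refl
  ∑-+ (x ∷ xs) g h = begin
    (g x + h x) + ∑ xs (λ y → g y + h y) ≡⟨ cong ((g x + h x) +_) (∑-+ xs g h) ⟩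
    (g x + h x) + (∑ xs g + ∑ xs h)      ≡⟨ interchange (g x) (h x) (∑ xs g) (∑ xs h) ⟩
    (g x + ∑ xs g) + (h x + ∑ xs h)      ∎
    where
    open ≡-Reasoning
    interchange : ∀ a b c d → (a + b) + (c + d) ≡ (a + c) + (b + d)
    interchange = solve-∀

  ∑-*ˡ : ∀ c (xs : List A) (g : A → ℕ) → ∑ xs (λ x → c * g x) ≡ c * ∑ xs g
  ∑-*ˡ c []       g = sym (ℕ.*-zeroʳ c)
  ∑-*ˡ c (x ∷ xs) g =
    trans (cong (c * g x +_) (∑-*ˡ c xs g)) (sym (ℕ.*-distribˡ-+ c (g x) (∑ xs g)))

  ∑-*ʳ : ∀ c (xs : List A) (g : A → ℕ) → ∑ xs (λ x → g x * c) ≡ ∑ xs g * c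
  ∑-*ʳ c xs g =
    trans (∑-cong xs (λ x → ℕ.*-comm (g x) c)) (trans (∑-*ˡ c xs g) (ℕ.*-comm c _))

  ∑-swap : ∀ (xs : List A) (ys : List B) (g : A → B → ℕ) →
           ∑ xs (λ x → ∑ ys (g x)) ≡ ∑ ys (λ y → ∑ xs (λ x → g x y))
  ∑-swap []       ys g = sym (trans (∑-const ys 0) (ℕ.*-zeroʳ (length ys)))
  ∑-swap (x ∷ xs) ys g =
    trans (cong (∑ ys (g x) +_) (∑-swap xs ys g))
          (sym (∑-+ ys (g x) (λ y → ∑ xs (λ x → g x y))))

  ∑-*-∑ : ∀ (xs ys : List A) (g h : A → ℕ) →
          ∑ xs g * ∑ ys h ≡ ∑ xs (λ x → ∑ ys (λ y → g x * h y))
  ∑-*-∑ xs ys g h =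
    trans (sym (∑-*ʳ (∑ ys h) xs g)) (∑-cong xs (λ x → sym (∑-*ˡ (g x) ys h)))

  ∑-allFin-suc : ∀ (g : Fin (suc n) → ℕ) →
                 ∑ (allFin (suc n)) g ≡ g zero + ∑ (allFin n) (g ∘ suc)
  ∑-allFin-suc {n} g = cong (λ ys → g zero + sum ys) (begin
    map g (tabulate suc)         ≡⟨ cong (map g) (map-tabulate (λ i → i) suc) ⟨
    map g (map suc (allFin n))   ≡⟨ map-∘ (allFin n) ⟨
    map (g ∘ suc) (allFin n)     ∎)
    where open ≡-Reasoning

  term≤∑ : ∀ {x : A} {xs} → x ∈ xs → (g : A → ℕ) → g x ≤ ∑ xs g
  term≤∑ (here refl) g = ℕ.m≤m+n _ _
  term≤∑ (there x∈)  g = ℕ.m≤n⇒m≤o+n _ (term≤∑ x∈ g)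

  -- A doubly indexed sum of w is at most that of any c dominating the
  -- symmetrization of w; the two orders of each pair may share a cost
  -- unevenly.
  ∑∑-symmetrize : ∀ (xs : List A) (w c : A → A → ℕ) →
                  (∀ x y → 2 * w x y ≤ c x y + c y x) →
                  ∑ xs (λ x → ∑ xs (w x)) ≤ ∑ xs (λ x → ∑ xs (c x))
  ∑∑-symmetrize xs w c 2w≤c+c = ℕ.*-cancelˡ-≤ 2 (begin
    2 * ∑ xs (λ x → ∑ xs (w x))                         ≡⟨ ∑-*ˡ 2 xs _ ⟨
    ∑ xs (λ x → 2 * ∑ xs (w x))                         ≡⟨ ∑-cong xs (λ x → ∑-*ˡ 2 xs (w x)) ⟨
    ∑ xs (λ x → ∑ xs (λ y → 2 * w x y))                 ≤⟨ ∑-mono′ xs (λ x → ∑-mono′ xs (2w≤c+c x)) ⟩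
    ∑ xs (λ x → ∑ xs (λ y → c x y + c y x))             ≡⟨ ∑-cong xs (λ x → ∑-+ xs (c x) (λ y → c y x)) ⟩
    ∑ xs (λ x → ∑ xs (c x) + ∑ xs (λ y → c y x))        ≡⟨ ∑-+ xs _ _ ⟩
    C + ∑ xs (λ x → ∑ xs (λ y → c y x))                 ≡⟨ cong (C +_) (∑-swap xs xs (λ x y → c y x)) ⟩
    C + C                                               ≡⟨ cong (C +_) (ℕ.+-identityʳ C) ⟨
    2 * C                                               ∎)
    where
    open ℕ.≤-Reasoning
    C = ∑ xs (λ x → ∑ xs (c x))

  -- Indicators and cardinalities

  -- The indicator of a decidable proposition.
  ⟦_⟧ : {P : Set} → Dec P → ℕ
  ⟦ P? ⟧ = if does P? then 1 else 0

  module _ {P : Set} where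

    ⟦⟧-true : (P? : Dec P) → P → ⟦ P? ⟧ ≡ 1
    ⟦⟧-true (yes _) p = refl
    ⟦⟧-true (no ¬p) p = contradiction p ¬p

    ⟦⟧-false : (P? : Dec P) → ¬ P → ⟦ P? ⟧ ≡ 0
    ⟦⟧-false (yes p) ¬p = contradiction p ¬p
    ⟦⟧-false (no _)  ¬p = refl

  ⟦⟧-mono : {P Q : Set} (P? : Dec P) (Q? : Dec Q) → (P → Q) → ⟦ P? ⟧ ≤ ⟦ Q? ⟧
  ⟦⟧-mono (yes p) Q? f = ℕ.≤-reflexive (sym (⟦⟧-true Q? (f p)))
  ⟦⟧-mono (no _)  Q? f = z≤n

  ⟦⟧-∩ : ∀ x (F G : Subset n) → ⟦ x ∈? F ⟧ * ⟦ x ∈? G ⟧ ≡ ⟦ x ∈? (F ∩ G) ⟧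
  ⟦⟧-∩ x F G with x ∈? F | x ∈? G
  ... | yes x∈F | yes x∈G = sym (⟦⟧-true  (x ∈? (F ∩ G)) (x∈p∩q⁺ (x∈F , x∈G)))
  ... | yes _   | no  x∉G = sym (⟦⟧-false (x ∈? (F ∩ G)) (x∉G ∘ proj₂ ∘ x∈p∩q⁻ F G))
  ... | no  x∉F | _       = sym (⟦⟧-false (x ∈? (F ∩ G)) (x∉F ∘ proj₁ ∘ x∈p∩q⁻ F G))

  length-filter≡∑ : {P : A → Set} (P? : Decidable P) (xs : List A) →
                    length (filter P? xs) ≡ ∑ xs (λ x → ⟦ P? x ⟧)
  length-filter≡∑ P? []       = refl
  length-filter≡∑ P? (x ∷ xs) with P? x
  ... | yes _ = cong suc (length-filter≡∑ P? xs)
  ... | no  _ = length-filter≡∑ P? xs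

  ∣F∣≡∑ : (F : Subset n) → ∣ F ∣ ≡ ∑ (allFin n) (λ x → ⟦ x ∈? F ⟧)
  ∣F∣≡∑ [] = refl
  ∣F∣≡∑ {suc n} (s ∷ F) = begin
    ∣ s ∷ F ∣                                                  ≡⟨ head s ⟩
    ⟦ zero ∈? s ∷ F ⟧ + ∣ F ∣                                  ≡⟨ cong (⟦ zero ∈? s ∷ F ⟧ +_) (∣F∣≡∑ F) ⟩
    ⟦ zero ∈? s ∷ F ⟧ + ∑ (allFin n) (λ x → ⟦ x ∈? F ⟧)        ≡⟨ ∑-allFin-suc (λ x → ⟦ x ∈? s ∷ F ⟧) ⟨
    ∑ (allFin (suc n)) (λ x → ⟦ x ∈? s ∷ F ⟧)                  ∎
    where
    open ≡-Reasoning
    head : ∀ s → ∣ s ∷ F ∣ ≡ ⟦ zero ∈? s ∷ F ⟧ + ∣ F ∣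
    head inside  = refl
    head outside = refl

  ∑-≟-∉ : ∀ {𝓕 : List (Subset n)} {H} → All (H ≢_) 𝓕 → ∑ 𝓕 (λ G → ⟦ G ≟ˢ H ⟧) ≡ 0
  ∑-≟-∉ []               = refl
  ∑-≟-∉ {H = H} (_∷_ {x = G} H≢G H∉) = cong₂ _+_ (⟦⟧-false (G ≟ˢ H) (H≢G ∘ sym)) (∑-≟-∉ H∉)

  ∑-≟≤1 : ∀ {𝓕 : List (Subset n)} → Unique 𝓕 → ∀ H → ∑ 𝓕 (λ G → ⟦ G ≟ˢ H ⟧) ≤ 1
  ∑-≟≤1 [] H = z≤n
  ∑-≟≤1 {𝓕 = F ∷ 𝓕} (F∉ ∷ 𝓕!) H with F ≟ˢ H
  ... | yes refl = ℕ.≤-reflexive (cong suc (∑-≟-∉ F∉))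
  ... | no  _    = ∑-≟≤1 𝓕! H

  ∑-≟-weighted : ∀ {𝓕 : List (Subset n)} → Unique 𝓕 → ∀ H c → ∑ 𝓕 (λ G → c * ⟦ G ≟ˢ H ⟧) ≤ c
  ∑-≟-weighted {𝓕 = 𝓕} 𝓕! H c = begin
    ∑ 𝓕 (λ G → c * ⟦ G ≟ˢ H ⟧)    ≡⟨ ∑-*ˡ c 𝓕 _ ⟩
    c * ∑ 𝓕 (λ G → ⟦ G ≟ˢ H ⟧)    ≤⟨ ℕ.*-monoʳ-≤ c (∑-≟≤1 𝓕! H) ⟩
    c * 1                         ≡⟨ ℕ.*-identityʳ c ⟩
    c                             ∎
    where open ℕ.≤-Reasoning

  ∈⇒1≤∑-≟ : ∀ {𝓕 : List (Subset n)} {H} → H ∈ 𝓕 → 1 ≤ ∑ 𝓕 (λ G → ⟦ G ≟ˢ H ⟧)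
  ∈⇒1≤∑-≟ {H = H} (here refl) = ℕ.m≤n⇒m≤n+o _ (ℕ.≤-reflexive (sym (⟦⟧-true (H ≟ˢ H) refl)))
  ∈⇒1≤∑-≟ (there H∈)  = ℕ.m≤n⇒m≤o+n _ (∈⇒1≤∑-≟ H∈)

  x∈F⇒∣F∣≢0 : ∀ {F : Subset n} {x} → x ∈ˢ F → ∣ F ∣ ≢ 0
  x∈F⇒∣F∣≢0 {F = F} {x} x∈F ∣F∣≡0 = contradiction (subst (∣ F - x ∣ <_) ∣F∣≡0 (x∈p⇒∣p-x∣<∣p∣ x∈F)) λ ()

  ∣F∣≢0⇒Nonempty : ∀ (F : Subset n) → ∣ F ∣ ≢ 0 → Nonempty F
  ∣F∣≢0⇒Nonempty {n} F ∣F∣≢0 with nonempty? F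
  ... | yes F≠∅ = F≠∅
  ... | no  F=∅ = contradiction (trans (cong ∣_∣ (Empty-unique F=∅)) (∣⊥∣≡0 n)) ∣F∣≢0

  ⊆⇒≡⊎⊂ : ∀ {F G : Subset n} → F ⊆ G → F ≡ G ⊎ F ⊂ G
  ⊆⇒≡⊎⊂ {F = F} {G} F⊆G with Fin.any? (λ x → x ∈? G ×-dec ¬? (x ∈? F))
  ... | yes (x , x∈G , x∉F) = inj₂ (F⊆G , x , x∈G , x∉F)
  ... | no  G∖F=∅ = inj₁ (⊆-antisym F⊆G G⊆F)
    where
    G⊆F : G ⊆ F
    G⊆F {x} x∈G with x ∈? F
    ... | yes x∈F = x∈F
    ... | no  x∉F = contradiction (x , x∈G , x∉F) G∖F=∅

  -- Reduction to saturated families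

  -- Every point covered by the family is itself a singleton member.
  Saturated : List (Subset n) → Set
  Saturated 𝓕 = ∀ {F x} → F ∈ 𝓕 → x ∈ˢ F → ⁅ x ⁆ ∈ 𝓕

  ∣F∩⁅x⁆∣≢0⇒x∈F : ∀ (F : Subset n) x → ∣ F ∩ ⁅ x ⁆ ∣ ≢ 0 → x ∈ˢ F
  ∣F∩⁅x⁆∣≢0⇒x∈F F x meet with ∣F∣≢0⇒Nonempty (F ∩ ⁅ x ⁆) meet
  ... | y , y∈ with x∈p∩q⁻ F ⁅ x ⁆ y∈
  ...   | y∈F , y∈⁅x⁆ = subst (_∈ˢ F) (x∈⁅y⁆⇒x≡y x y∈⁅x⁆) y∈F

  shrink-∩ : ∀ {F : Subset n} {x} G → x ∈ˢ F → ∣ G ∩ ⁅ x ⁆ ∣ ≢ 0 → ∣ G ∩ F ∣ ≢ 0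
  shrink-∩ {x = x} G x∈F meet = x∈F⇒∣F∣≢0 (x∈p∩q⁺ (∣F∩⁅x⁆∣≢0⇒x∈F G x meet , x∈F))

  -- Shrinking a member to an absent singleton inside it can only destroy
  -- intersections.
  shrink-almostFisher : ∀ {k x} {F : Subset n} {𝓕} → x ∈ˢ F → ⁅ x ⁆ ∉ F ∷ 𝓕 →
                        AlmostFisher k 0 (F ∷ 𝓕) → AlmostFisher k 0 (⁅ x ⁆ ∷ 𝓕)
  shrink-almostFisher {n} {k} {x} {F} {𝓕} x∈F ⁅x⁆∉ (F≢ ∷ 𝓕! , deg-F ∷ deg-𝓕) =
    ¬Any⇒All¬ 𝓕 (⁅x⁆∉ ∘ there) ∷ 𝓕! ,
    ℕ.≤-trans (degree-mono _ _ selfless (All.map (λ F≢G → shrink-head F≢G) F≢)) deg-F ∷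
    All.zipWith (λ {G} (F≢G , deg-G) →
      ℕ.≤-trans (degree-mono G G (shrink-other F≢G) (All.universal (λ _ e → e) 𝓕)) deg-G)
      (F≢ , deg-𝓕)
    where
    -- The list positions of F and ⁅ x ⁆ correspond; the degrees compare
    -- entry by entry.
    degree-mono : ∀ (G G′ : Subset n) →
                  (Exceptional 0 G ⁅ x ⁆ → Exceptional 0 G′ F) →
                  All (λ H → Exceptional 0 G H → Exceptional 0 G′ H) 𝓕 →
                  length (filter (exceptional? 0 G) (⁅ x ⁆ ∷ 𝓕)) ≤
                  length (filter (exceptional? 0 G′) (F ∷ 𝓕))
    degree-mono G G′ head tail =
      subst₂ _≤_ (sym (length-filter≡∑ (exceptional? 0 G) (⁅ x ⁆ ∷ 𝓕)))
                 (sym (length-filter≡∑ (exceptional? 0 G′) (F ∷ 𝓕)))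
        (ℕ.+-mono-≤ (⟦⟧-mono (exceptional? 0 G ⁅ x ⁆) (exceptional? 0 G′ F) head)
          (∑-mono (All.map (λ {H} → ⟦⟧-mono (exceptional? 0 G H) (exceptional? 0 G′ H)) tail)))

    selfless : Exceptional 0 ⁅ x ⁆ ⁅ x ⁆ → Exceptional 0 F F
    selfless (≢self , _) = contradiction refl ≢self

    shrink-head : ∀ {G} → F ≢ G → Exceptional 0 ⁅ x ⁆ G → Exceptional 0 F G
    shrink-head {G} F≢G (_ , meet) = F≢G ∘ sym ,
      subst (λ H → ∣ H ∣ ≢ 0) (∩-comm G F)
        (shrink-∩ G x∈F (subst (λ H → ∣ H ∣ ≢ 0) (∩-comm ⁅ x ⁆ G) meet))

    shrink-other : ∀ {G} → F ≢ G → Exceptional 0 G ⁅ x ⁆ → Exceptional 0 G F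
    shrink-other {G} F≢G (_ , meet) = F≢G , shrink-∩ G x∈F meet

  ∈⇒↭∷ : ∀ {x : A} {xs} → x ∈ xs → ∃[ ys ] xs ↭ x ∷ ys
  ∈⇒↭∷ x∈xs with ys , zs , eq ← ∈-∃++ x∈xs = _ , ↭-trans (↭-reflexive eq) (shift _ ys zs)

  -- Every family can be shrunk to a saturated one; the total size of the
  -- members decreases at each replacement.
  saturate : ∀ {k} (𝓕 : List (Subset n)) → AlmostFisher k 0 𝓕 →
             ∃[ 𝓖 ] AlmostFisher k 0 𝓖 × length 𝓖 ≡ length 𝓕 × Saturated 𝓖
  saturate {n} {k} 𝓕 fisher = go 𝓕 fisher (<-wellFounded (∑ 𝓕 ∣_∣))
    where
    open DecMembership (_≟ˢ_ {n}) using () renaming (_∈?_ to _∈ᶠ?_)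

    go : ∀ 𝓕 → AlmostFisher k 0 𝓕 → Acc _<_ (∑ 𝓕 ∣_∣) →
         ∃[ 𝓖 ] AlmostFisher k 0 𝓖 × length 𝓖 ≡ length 𝓕 × Saturated 𝓖
    go 𝓕 fisher (acc rec)
      with any? (λ F → Fin.any? (λ x → x ∈? F ×-dec ¬? (⁅ x ⁆ ∈ᶠ? 𝓕))) 𝓕
    ... | no unsaturated = 𝓕 , fisher , refl , saturated
      where
      saturated : Saturated 𝓕
      saturated {F} {x} F∈𝓕 x∈F with ⁅ x ⁆ ∈ᶠ? 𝓕
      ... | yes ⁅x⁆∈𝓕 = ⁅x⁆∈𝓕
      ... | no  ⁅x⁆∉𝓕 = contradiction (lose F∈𝓕 (x , x∈F , ⁅x⁆∉𝓕)) unsaturated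
    ... | yes found
      with F , F∈𝓕 , x , x∈F , ⁅x⁆∉𝓕 ← find found
      with 𝓕′ , 𝓕↭ ← ∈⇒↭∷ F∈𝓕
      with go (⁅ x ⁆ ∷ 𝓕′) shrunk (rec smaller)
      where
      ⁅x⁆∉ : ⁅ x ⁆ ∉ F ∷ 𝓕′
      ⁅x⁆∉ = ⁅x⁆∉𝓕 ∘ ∈-resp-↭ (↭-sym 𝓕↭)

      shrunk : AlmostFisher k 0 (⁅ x ⁆ ∷ 𝓕′)
      shrunk = shrink-almostFisher x∈F ⁅x⁆∉
        (AlmostFisher-resp-↭ 𝓕↭ (↭ₛ.Unique-resp-↭ (setoid _) (↭⇒↭ₛ 𝓕↭) (proj₁ fisher)) fisher)

      ⁅x⁆⊂F : ⁅ x ⁆ ⊂ F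
      ⁅x⁆⊂F with ⊆⇒≡⊎⊂ {F = ⁅ x ⁆} {F} (λ y∈ → subst (_∈ˢ F) (sym (x∈⁅y⁆⇒x≡y x y∈)) x∈F)
      ... | inj₁ refl = contradiction F∈𝓕 ⁅x⁆∉𝓕
      ... | inj₂ ⊂F   = ⊂F

      smaller : ∑ (⁅ x ⁆ ∷ 𝓕′) ∣_∣ < ∑ 𝓕 ∣_∣
      smaller = ℕ.<-≤-trans (ℕ.+-monoˡ-< (∑ 𝓕′ ∣_∣) (p⊂q⇒∣p∣<∣q∣ ⁅x⁆⊂F))
                            (ℕ.≤-reflexive (sym (sum-↭ (map⁺ ∣_∣ 𝓕↭))))
    ... | 𝓖 , 𝓖-fisher , len , sat =
      𝓖 , 𝓖-fisher , trans len (sym (↭-length 𝓕↭)) , sat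

  -- The charging argument

  -- F contains x as well as some further point, so that F - x is nonempty.
  proper? : ∀ (F : Subset n) x → Dec (x ∈ˢ F × F ≢ ⁅ x ⁆)
  proper? F x = x ∈? F ×-dec ¬? (F ≟ˢ ⁅ x ⁆)

  -- The number of points x of F for which G is F - x and is nonempty; it is
  -- 1 or 0, but the form of a sum over x is what gets summed over members.
  coatoms : Subset n → Subset n → ℕ
  coatoms {n} F G = ∑ (allFin n) (λ x → ⟦ proper? F x ⟧ * ⟦ G ≟ˢ (F - x) ⟧)

  -- The share of 2 |F ∩ G| that F pays for the pair (F , G): the basic
  -- payment |F| - 1 if the two are distinct and meet, a surcharge if G is
  -- nonempty and is F with a point deleted, and |F| if G is F itself.
  charge : Subset n → Subset n → ℕ
  charge F G = ⟦ exceptional? 0 F G ⟧ * (∣ F ∣ ∸ 1) + (coatoms F G + ⟦ G ≟ˢ F ⟧ * ∣ F ∣)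

  1≤coatoms : ∀ {F : Subset n} {x} → x ∈ˢ F → F ≢ ⁅ x ⁆ → 1 ≤ coatoms F (F - x)
  1≤coatoms {n} {F} {x} x∈F F≢⁅x⁆ = ℕ.≤-trans
    (ℕ.≤-reflexive (sym (cong₂ _*_ (⟦⟧-true (proper? F x) (x∈F , F≢⁅x⁆))
                                   (⟦⟧-true ((F - x) ≟ˢ (F - x)) refl))))
    (term≤∑ (∈-allFin x) (λ y → ⟦ proper? F y ⟧ * ⟦ (F - x) ≟ˢ (F - y) ⟧))

  exceptional-charge : ∀ {F G : Subset n} → G ≢ F → ∣ F ∩ G ∣ ≢ 0 →
                       ∣ F ∣ ∸ 1 + coatoms F G ≤ charge F G
  exceptional-charge {F = F} {G} G≢F meet = begin
    ∣ F ∣ ∸ 1 + coatoms F G                                    ≡⟨ cong (_+ coatoms F G) (ℕ.*-identityˡ (∣ F ∣ ∸ 1)) ⟨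
    1 * (∣ F ∣ ∸ 1) + coatoms F G                              ≡⟨ cong (λ e → e * (∣ F ∣ ∸ 1) + coatoms F G) (⟦⟧-true (exceptional? 0 F G) (G≢F , meet)) ⟨
    ⟦ exceptional? 0 F G ⟧ * (∣ F ∣ ∸ 1) + coatoms F G         ≤⟨ ℕ.+-monoʳ-≤ _ (ℕ.m≤m+n (coatoms F G) _) ⟩
    charge F G                                                 ∎
    where open ℕ.≤-Reasoning

  2m≤m∸1+n∸1 : ∀ {m n} → 2 + m ≤ n → 2 * m ≤ (m ∸ 1) + (n ∸ 1)
  2m≤m∸1+n∸1 {zero}  _ = z≤n
  2m≤m∸1+n∸1 {suc m} (s≤s 2+m≤n) = begin
    2 * suc m                ≡⟨ rearrange m ⟩
    m + (2 + m)              ≤⟨ ℕ.+-monoʳ-≤ m 2+m≤n ⟩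
    m + _                    ∎
    where
    open ℕ.≤-Reasoning
    rearrange : ∀ m → 2 * suc m ≡ m + (2 + m)
    rearrange = solve-∀

  -- For F properly inside G the two basic payments fall short of 2 |F| only
  -- if |G| = |F| + 1, and then the surcharge makes up the difference.
  ⊂-charge : ∀ {F G : Subset n} → F ⊂ G → ∣ F ∣ ≢ 0 →
             2 * ∣ F ∣ ≤ (∣ F ∣ ∸ 1) + (∣ G ∣ ∸ 1 + coatoms G F)
  ⊂-charge {F = F} {G} (F⊆G , x , x∈G , x∉F) F≢∅ with F ≟ˢ (G - x)
  ... | yes refl = begin
      2 * ∣ F ∣                                         ≤⟨ step ∣ F ∣ ∣ G ∣ (x∈p⇒∣p-x∣<∣p∣ x∈G) ⟩
      (∣ F ∣ ∸ 1) + (∣ G ∣ ∸ 1 + 1)                     ≤⟨ ℕ.+-monoʳ-≤ (∣ F ∣ ∸ 1) (ℕ.+-monoʳ-≤ (∣ G ∣ ∸ 1) (1≤coatoms x∈G G≢⁅x⁆)) ⟩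
      (∣ F ∣ ∸ 1) + (∣ G ∣ ∸ 1 + coatoms G F)           ∎
    where
    open ℕ.≤-Reasoning
    step : ∀ s t → s < t → 2 * s ≤ (s ∸ 1) + (t ∸ 1 + 1)
    step zero    t       _         = z≤n
    step (suc s) (suc t) (s≤s s<t) = begin
      2 * suc s           ≡⟨ rearrange s ⟩
      s + (suc s + 1)     ≤⟨ ℕ.+-monoʳ-≤ s (ℕ.+-monoˡ-≤ 1 s<t) ⟩
      s + (t + 1)         ∎
      where
      rearrange : ∀ m → 2 * suc m ≡ m + (suc m + 1)
      rearrange = solve-∀
    G≢⁅x⁆ : G ≢ ⁅ x ⁆
    G≢⁅x⁆ G≡⁅x⁆ with y , y∈F ← ∣F∣≢0⇒Nonempty F F≢∅ =
      x∉F (subst (_∈ˢ F) (x∈⁅y⁆⇒x≡y x (subst (y ∈ˢ_) G≡⁅x⁆ (F⊆G y∈F))) y∈F)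
  ... | no F≢G-x with ⊆⇒≡⊎⊂ {F = F} {G - x} F⊆G-x
    where
    F⊆G-x : F ⊆ G - x
    F⊆G-x y∈F = x∈p∧x≢y⇒x∈p-y (F⊆G y∈F) (λ { refl → x∉F y∈F })
  ...   | inj₁ F≡G-x = contradiction F≡G-x F≢G-x
  ...   | inj₂ F⊂G-x = ℕ.≤-trans
            (2m≤m∸1+n∸1 (ℕ.≤-trans (s≤s (p⊂q⇒∣p∣<∣q∣ F⊂G-x)) (x∈p⇒∣p-x∣<∣p∣ x∈G)))
            (ℕ.+-monoʳ-≤ (∣ F ∣ ∸ 1) (ℕ.m≤m+n (∣ G ∣ ∸ 1) _))

  self-charge : ∀ (F : Subset n) → 2 * ∣ F ∩ F ∣ ≤ charge F F + charge F F
  self-charge F = begin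
    2 * ∣ F ∩ F ∣              ≡⟨ cong (λ H → 2 * ∣ H ∣) (∩-idem F) ⟩
    2 * ∣ F ∣                  ≡⟨ cong (∣ F ∣ +_) (ℕ.+-identityʳ ∣ F ∣) ⟩
    ∣ F ∣ + ∣ F ∣              ≤⟨ ℕ.+-mono-≤ self self ⟩
    charge F F + charge F F    ∎
    where
    open ℕ.≤-Reasoning
    self : ∣ F ∣ ≤ charge F F
    self = ℕ.m≤n⇒m≤o+n (⟦ exceptional? 0 F F ⟧ * (∣ F ∣ ∸ 1)) (ℕ.m≤n⇒m≤o+n (coatoms F F) (ℕ.≤-reflexive
      (sym (trans (cong (_* ∣ F ∣) (⟦⟧-true (F ≟ˢ F) refl)) (ℕ.*-identityˡ ∣ F ∣)))))

  -- If neither set contains the other, |F ∩ G| is smaller than both sizes and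
  -- the basic payments suffice; otherwise the inclusion is proper.
  exceptional-pair-charge : ∀ (F G : Subset n) → G ≢ F → ∣ F ∩ G ∣ ≢ 0 →
                            2 * ∣ F ∩ G ∣ ≤ charge F G + charge G F
  exceptional-pair-charge F G G≢F meet =
    ℕ.≤-trans (split (⊆⇒≡⊎⊂ (p∩q⊆p F G)) (⊆⇒≡⊎⊂ (p∩q⊆q F G)))
      (ℕ.+-mono-≤ (exceptional-charge G≢F meet)
        (exceptional-charge (G≢F ∘ sym) (subst (λ H → ∣ H ∣ ≢ 0) (∩-comm F G) meet)))
    where
    open ℕ.≤-Reasoning
    i = ∣ F ∩ G ∣
    F′ = ∣ F ∣ ∸ 1
    G′ = ∣ G ∣ ∸ 1

    split : F ∩ G ≡ F ⊎ F ∩ G ⊂ F → F ∩ G ≡ G ⊎ F ∩ G ⊂ G →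
            2 * i ≤ (F′ + coatoms F G) + (G′ + coatoms G F)
    split (inj₁ F∩G≡F) _ with ⊆⇒≡⊎⊂ (subst (_⊆ G) F∩G≡F (p∩q⊆q F G))
    ... | inj₁ F≡G = contradiction (sym F≡G) G≢F
    ... | inj₂ F⊂G = begin
      2 * ∣ F ∩ G ∣                              ≡⟨ cong (λ H → 2 * ∣ H ∣) F∩G≡F ⟩
      2 * ∣ F ∣                                  ≤⟨ ⊂-charge F⊂G (subst (λ H → ∣ H ∣ ≢ 0) F∩G≡F meet) ⟩
      F′ + (G′ + coatoms G F)                    ≤⟨ ℕ.+-monoˡ-≤ _ (ℕ.m≤m+n F′ (coatoms F G)) ⟩
      (F′ + coatoms F G) + (G′ + coatoms G F)    ∎
    split (inj₂ _) (inj₁ F∩G≡G) with ⊆⇒≡⊎⊂ (subst (_⊆ F) F∩G≡G (p∩q⊆p F G))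
    ... | inj₁ G≡F = contradiction G≡F G≢F
    ... | inj₂ G⊂F = begin
      2 * ∣ F ∩ G ∣                              ≡⟨ cong (λ H → 2 * ∣ H ∣) F∩G≡G ⟩
      2 * ∣ G ∣                                  ≤⟨ ⊂-charge G⊂F (subst (λ H → ∣ H ∣ ≢ 0) F∩G≡G meet) ⟩
      G′ + (F′ + coatoms F G)                    ≡⟨ ℕ.+-comm G′ _ ⟩
      (F′ + coatoms F G) + G′                    ≤⟨ ℕ.+-monoʳ-≤ (F′ + coatoms F G) (ℕ.m≤m+n G′ (coatoms G F)) ⟩
      (F′ + coatoms F G) + (G′ + coatoms G F)    ∎
    split (inj₂ F∩G⊂F) (inj₂ F∩G⊂G) = begin
      2 * i                                      ≡⟨ cong (i +_) (ℕ.+-identityʳ i) ⟩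
      i + i                                      ≤⟨ ℕ.+-mono-≤ (ℕ.<⇒≤pred (p⊂q⇒∣p∣<∣q∣ F∩G⊂F)) (ℕ.<⇒≤pred (p⊂q⇒∣p∣<∣q∣ F∩G⊂G)) ⟩
      F′ + G′                                    ≤⟨ ℕ.+-mono-≤ (ℕ.m≤m+n F′ (coatoms F G)) (ℕ.m≤m+n G′ (coatoms G F)) ⟩
      (F′ + coatoms F G) + (G′ + coatoms G F)    ∎

  2∣F∩G∣≤charges : ∀ (F G : Subset n) → 2 * ∣ F ∩ G ∣ ≤ charge F G + charge G F
  2∣F∩G∣≤charges F G = cases (G ≟ˢ F) (∣ F ∩ G ∣ ℕ.≟ 0)
    where
    cases : Dec (G ≡ F) → Dec (∣ F ∩ G ∣ ≡ 0) → 2 * ∣ F ∩ G ∣ ≤ charge F G + charge G F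
    cases (yes refl) _              = self-charge F
    cases (no _)     (yes disjoint) = subst (λ i → 2 * i ≤ charge F G + charge G F) (sym disjoint) z≤n
    cases (no G≢F)   (no meet)      = exceptional-pair-charge F G G≢F meet

  -- The total paid by F: at most k basic payments, one surcharge for each
  -- point at most, and |F| for itself.
  ∑-charge : ∀ {k} {𝓕 : List (Subset n)} → AlmostFisher k 0 𝓕 → ∀ {F} → F ∈ 𝓕 →
             ∑ 𝓕 (charge F) ≤
             k * (∣ F ∣ ∸ 1) + (∑ (allFin n) (λ x → ⟦ proper? F x ⟧) + ∣ F ∣)
  ∑-charge {n} {k} {𝓕} (𝓕! , degrees) {F} F∈𝓕 = begin
    ∑ 𝓕 (charge F)
      ≡⟨ ∑-+ 𝓕 _ _ ⟩
    ∑ 𝓕 (λ G → ⟦ exceptional? 0 F G ⟧ * (∣ F ∣ ∸ 1)) + ∑ 𝓕 (λ G → coatoms F G + ⟦ G ≟ˢ F ⟧ * ∣ F ∣)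
      ≡⟨ cong₂ _+_ (∑-*ʳ (∣ F ∣ ∸ 1) 𝓕 _) (∑-+ 𝓕 _ _) ⟩
    ∑ 𝓕 (λ G → ⟦ exceptional? 0 F G ⟧) * (∣ F ∣ ∸ 1) + (∑ 𝓕 (coatoms F) + ∑ 𝓕 (λ G → ⟦ G ≟ˢ F ⟧ * ∣ F ∣))
      ≤⟨ ℕ.+-mono-≤ (ℕ.*-monoˡ-≤ (∣ F ∣ ∸ 1) exceptional≤k) (ℕ.+-mono-≤ ∑-coatoms ∑-self) ⟩
    k * (∣ F ∣ ∸ 1) + (∑ (allFin n) (λ x → ⟦ proper? F x ⟧) + ∣ F ∣)
      ∎
    where
    open ℕ.≤-Reasoning
    exceptional≤k : ∑ 𝓕 (λ G → ⟦ exceptional? 0 F G ⟧) ≤ k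
    exceptional≤k = subst (_≤ k) (length-filter≡∑ (exceptional? 0 F) 𝓕) (All.lookup degrees F∈𝓕)

    ∑-coatoms : ∑ 𝓕 (coatoms F) ≤ ∑ (allFin n) (λ x → ⟦ proper? F x ⟧)
    ∑-coatoms = begin
      ∑ 𝓕 (coatoms F)
        ≡⟨ ∑-swap 𝓕 (allFin n) _ ⟩
      ∑ (allFin n) (λ x → ∑ 𝓕 (λ G → ⟦ proper? F x ⟧ * ⟦ G ≟ˢ (F - x) ⟧))
        ≤⟨ ∑-mono′ (allFin n) (λ x → ∑-≟-weighted 𝓕! (F - x) ⟦ proper? F x ⟧) ⟩
      ∑ (allFin n) (λ x → ⟦ proper? F x ⟧)
        ∎

    ∑-self : ∑ 𝓕 (λ G → ⟦ G ≟ˢ F ⟧ * ∣ F ∣) ≤ ∣ F ∣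
    ∑-self = ℕ.≤-trans (ℕ.≤-reflexive (∑-cong 𝓕 (λ G → ℕ.*-comm ⟦ G ≟ˢ F ⟧ ∣ F ∣)))
                       (∑-≟-weighted 𝓕! F ∣ F ∣)

  -- Degrees of points

  -- The number of members containing x.
  degree : List (Subset n) → Fin n → ℕ
  degree 𝓕 x = ∑ 𝓕 (λ F → ⟦ x ∈? F ⟧)

  ∑-degree : ∀ (𝓕 : List (Subset n)) → ∑ (allFin n) (degree 𝓕) ≡ ∑ 𝓕 ∣_∣
  ∑-degree {n} 𝓕 = trans (∑-swap (allFin n) 𝓕 _) (∑-cong 𝓕 (λ F → sym (∣F∣≡∑ F)))

  ∑-degree² : ∀ (𝓕 : List (Subset n)) →
              ∑ (allFin n) (λ x → degree 𝓕 x * degree 𝓕 x) ≡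
              ∑ 𝓕 (λ F → ∑ 𝓕 (λ G → ∣ F ∩ G ∣))
  ∑-degree² {n} 𝓕 = begin
    ∑ V (λ x → degree 𝓕 x * degree 𝓕 x)
      ≡⟨ ∑-cong V (λ x → ∑-*-∑ 𝓕 𝓕 (λ F → ⟦ x ∈? F ⟧) (λ G → ⟦ x ∈? G ⟧)) ⟩
    ∑ V (λ x → ∑ 𝓕 (λ F → ∑ 𝓕 (λ G → ⟦ x ∈? F ⟧ * ⟦ x ∈? G ⟧)))
      ≡⟨ ∑-swap V 𝓕 _ ⟩
    ∑ 𝓕 (λ F → ∑ V (λ x → ∑ 𝓕 (λ G → ⟦ x ∈? F ⟧ * ⟦ x ∈? G ⟧)))
      ≡⟨ ∑-cong 𝓕 (λ F → ∑-swap V 𝓕 _) ⟩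
    ∑ 𝓕 (λ F → ∑ 𝓕 (λ G → ∑ V (λ x → ⟦ x ∈? F ⟧ * ⟦ x ∈? G ⟧)))
      ≡⟨ ∑-cong 𝓕 (λ F → ∑-cong 𝓕 (λ G →
           trans (∑-cong V (λ x → ⟦⟧-∩ x F G)) (sym (∣F∣≡∑ (F ∩ G))))) ⟩
    ∑ 𝓕 (λ F → ∑ 𝓕 (λ G → ∣ F ∩ G ∣))
      ∎
    where
    open ≡-Reasoning
    V = allFin n

  -- One is subtracted for the member ⁅ x ⁆, present whenever x is covered.
  ∑-proper : ∀ {𝓕 : List (Subset n)} → Saturated 𝓕 → ∀ x →
             ∑ 𝓕 (λ F → ⟦ proper? F x ⟧) ≤ degree 𝓕 x ∸ 1
  ∑-proper {n} {𝓕} saturated x with DecMembership._∈?_ _≟ˢ_ ⁅ x ⁆ 𝓕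
  ... | yes ⁅x⁆∈𝓕 = ℕ.m+n≤o⇒m≤o∸n _ (begin
      ∑ 𝓕 (λ F → ⟦ proper? F x ⟧) + 1
        ≤⟨ ℕ.+-monoʳ-≤ _ (∈⇒1≤∑-≟ ⁅x⁆∈𝓕) ⟩
      ∑ 𝓕 (λ F → ⟦ proper? F x ⟧) + ∑ 𝓕 (λ F → ⟦ F ≟ˢ ⁅ x ⁆ ⟧)
        ≡⟨ ∑-+ 𝓕 _ _ ⟨
      ∑ 𝓕 (λ F → ⟦ proper? F x ⟧ + ⟦ F ≟ˢ ⁅ x ⁆ ⟧)
        ≤⟨ ∑-mono′ 𝓕 proper+singleton ⟩
      degree 𝓕 x
        ∎)
    where
    open ℕ.≤-Reasoning
    proper+singleton : ∀ F → ⟦ proper? F x ⟧ + ⟦ F ≟ˢ ⁅ x ⁆ ⟧ ≤ ⟦ x ∈? F ⟧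
    proper+singleton F = cases (F ≟ˢ ⁅ x ⁆)
      where
      cases : Dec (F ≡ ⁅ x ⁆) → ⟦ proper? F x ⟧ + ⟦ F ≟ˢ ⁅ x ⁆ ⟧ ≤ ⟦ x ∈? F ⟧
      cases (yes F≡⁅x⁆) = ℕ.≤-reflexive (trans
        (cong₂ _+_ (⟦⟧-false (proper? F x) (λ (_ , F≢⁅x⁆) → F≢⁅x⁆ F≡⁅x⁆)) (⟦⟧-true (F ≟ˢ ⁅ x ⁆) F≡⁅x⁆))
        (sym (⟦⟧-true (x ∈? F) (subst (x ∈ˢ_) (sym F≡⁅x⁆) (x∈⁅x⁆ x)))))
      cases (no F≢⁅x⁆) = ℕ.≤-trans
        (ℕ.≤-reflexive (trans (cong (⟦ proper? F x ⟧ +_) (⟦⟧-false (F ≟ˢ ⁅ x ⁆) F≢⁅x⁆)) (ℕ.+-identityʳ _)))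
        (⟦⟧-mono (proper? F x) (x ∈? F) proj₁)
  ... | no ⁅x⁆∉𝓕 = ℕ.≤-trans (∑-mono {xs = 𝓕} {h = λ _ → 0} (All.tabulate λ {F} F∈𝓕 →
            ℕ.≤-reflexive (⟦⟧-false (proper? F x) (λ (x∈F , _) → ⁅x⁆∉𝓕 (saturated F∈𝓕 x∈F)))))
          (ℕ.≤-trans (ℕ.≤-reflexive (trans (∑-const 𝓕 0) (ℕ.*-zeroʳ (length 𝓕)))) z≤n)

  -- The term 1 on the right accounts for the empty set, whose truncated
  -- |F| ∸ 1 is 0 instead of -1.
  ∑-size : ∀ {𝓕 : List (Subset n)} → Unique 𝓕 →
           ∑ 𝓕 (λ F → ∣ F ∣ ∸ 1) + length 𝓕 ≤ ∑ 𝓕 ∣_∣ + 1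
  ∑-size {n} {𝓕} 𝓕! = begin
    ∑ 𝓕 (λ F → ∣ F ∣ ∸ 1) + length 𝓕
      ≡⟨ cong (∑ 𝓕 (λ F → ∣ F ∣ ∸ 1) +_) (trans (∑-const 𝓕 1) (ℕ.*-identityʳ _)) ⟨
    ∑ 𝓕 (λ F → ∣ F ∣ ∸ 1) + ∑ 𝓕 (λ _ → 1)
      ≡⟨ ∑-+ 𝓕 _ _ ⟨
    ∑ 𝓕 (λ F → ∣ F ∣ ∸ 1 + 1)
      ≤⟨ ∑-mono′ 𝓕 nonempty-or-⊥ ⟩
    ∑ 𝓕 (λ F → ∣ F ∣ + ⟦ F ≟ˢ ⊥ ⟧)
      ≡⟨ ∑-+ 𝓕 _ _ ⟩
    ∑ 𝓕 ∣_∣ + ∑ 𝓕 (λ F → ⟦ F ≟ˢ ⊥ ⟧)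
      ≤⟨ ℕ.+-monoʳ-≤ (∑ 𝓕 ∣_∣) (∑-≟≤1 𝓕! ⊥) ⟩
    ∑ 𝓕 ∣_∣ + 1
      ∎
    where
    open ℕ.≤-Reasoning
    nonempty-or-⊥ : ∀ (F : Subset n) → ∣ F ∣ ∸ 1 + 1 ≤ ∣ F ∣ + ⟦ F ≟ˢ ⊥ ⟧
    nonempty-or-⊥ F with nonempty? F
    ... | yes (x , x∈F) = ℕ.m≤n⇒m≤n+o _ (ℕ.≤-reflexive
            (ℕ.m∸n+n≡m (ℕ.n≢0⇒n>0 (x∈F⇒∣F∣≢0 x∈F))))
    ... | no  F=∅ = ℕ.+-mono-≤ (ℕ.m∸n≤m ∣ F ∣ 1)
            (ℕ.≤-reflexive (sym (⟦⟧-true (F ≟ˢ ⊥) (Empty-unique F=∅))))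

  -- Integer quadratic inequalities

  -- A form of (k - 2 b)² ≥ 0.
  4*k*b≤4*b²+k² : ∀ k b → k * b * 4 ≤ b * b * 4 + k ^ 2
  4*k*b≤4*b²+k² k b with ℕ.≤-total k (2 * b)
  ... | inj₁ k≤2b with j , eq ← ℕ.m≤n⇒∃[o]m+o≡n k≤2b = begin
      k * b * 4                      ≡⟨ e₁ k b ⟩
      2 * k * (2 * b)                ≡⟨ cong (2 * k *_) eq ⟨
      2 * k * (k + j)                ≤⟨ ℕ.m≤m+n _ (j * j) ⟩
      2 * k * (k + j) + j * j        ≡⟨ e₂ k j ⟩
      (k + j) * (k + j) + k ^ 2      ≡⟨ cong (λ m → m * m + k ^ 2) eq ⟩
      2 * b * (2 * b) + k ^ 2        ≡⟨ cong (_+ k ^ 2) (e₃ b) ⟩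
      b * b * 4 + k ^ 2              ∎
    where
    open ℕ.≤-Reasoning
    e₁ : ∀ k b → k * b * 4 ≡ 2 * k * (2 * b)
    e₁ = solve-∀
    -- k ^ 2 is written in its unfolded form k * (k * 1) for the ring solver.
    e₂ : ∀ k j → 2 * k * (k + j) + j * j ≡ (k + j) * (k + j) + k * (k * 1)
    e₂ = solve-∀
    e₃ : ∀ b → 2 * b * (2 * b) ≡ b * b * 4
    e₃ = solve-∀
  ... | inj₂ 2b≤k with j , refl ← ℕ.m≤n⇒∃[o]m+o≡n 2b≤k = begin
      (2 * b + j) * b * 4                    ≤⟨ ℕ.m≤m+n _ (j * j) ⟩
      (2 * b + j) * b * 4 + j * j            ≡⟨ e b j ⟩
      b * b * 4 + (2 * b + j) ^ 2            ∎
    where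
    open ℕ.≤-Reasoning
    e : ∀ b j → (2 * b + j) * b * 4 + j * j ≡ b * b * 4 + (2 * b + j) * ((2 * b + j) * 1)
    e = solve-∀

  -- The quotient may be rounded down because k b - b² is an integer.
  k*b≤b²+⌊k²/4⌋ : ∀ k b → k * b ≤ b * b + (k ^ 2) div 4
  k*b≤b²+⌊k²/4⌋ k b = ℕ.≤-trans (ℕ.m≤n+m∸n (k * b) (b * b)) (ℕ.+-monoʳ-≤ (b * b) (begin
    k * b ∸ b * b                        ≡⟨ m*n/n≡m (k * b ∸ b * b) 4 ⟨
    ((k * b ∸ b * b) * 4) div 4          ≤⟨ /-monoˡ-≤ 4 (ℕ.≤-trans (ℕ.≤-reflexive (ℕ.*-distribʳ-∸ 4 (k * b) (b * b)))
                                              (ℕ.m≤n+o⇒m∸n≤o (k * b * 4) (b * b * 4) (4*k*b≤4*b²+k² k b))) ⟩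
    (k ^ 2) div 4                        ∎))
    where open ℕ.≤-Reasoning

  -- The identity a² = b² + b + a for b = a - 1 survives truncation at a = 0.
  a²≡b²+a+b : ∀ a → a * a ≡ (a ∸ 1) * (a ∸ 1) + ((a ∸ 1) + a)
  a²≡b²+a+b zero    = refl
  a²≡b²+a+b (suc b) = expand b
    where
    expand : ∀ b → suc b * suc b ≡ b * b + (b + suc b)
    expand = solve-∀

  -- The bound for saturated families, and for all families

  module _ {k} {𝓕 : List (Subset n)} (fisher : AlmostFisher k 0 𝓕) (saturated : Saturated 𝓕) where

    -- a x is the number of members containing x, b x is that number without
    -- the member ⁅ x ⁆, and W adds up one basic payment for each member.
    private
      V = allFin n
      a b : Fin n → ℕ
      a = degree 𝓕
      b x = a x ∸ 1
      Σa = ∑ V a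
      Σb = ∑ V b
      W = ∑ 𝓕 (λ F → ∣ F ∣ ∸ 1)
      q = (k ^ 2) div 4

    ∑-degree²≤ : ∑ V (λ x → a x * a x) ≤ k * W + (Σb + Σa)
    ∑-degree²≤ = begin
      ∑ V (λ x → a x * a x)
        ≡⟨ ∑-degree² 𝓕 ⟩
      ∑ 𝓕 (λ F → ∑ 𝓕 (λ G → ∣ F ∩ G ∣))
        ≤⟨ ∑∑-symmetrize 𝓕 (λ F G → ∣ F ∩ G ∣) charge 2∣F∩G∣≤charges ⟩
      ∑ 𝓕 (λ F → ∑ 𝓕 (charge F))
        ≤⟨ ∑-mono (All.tabulate (∑-charge fisher)) ⟩
      ∑ 𝓕 (λ F → k * (∣ F ∣ ∸ 1) + (∑ V (λ x → ⟦ proper? F x ⟧) + ∣ F ∣))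
        ≡⟨ trans (∑-+ 𝓕 _ _) (cong₂ _+_ (∑-*ˡ k 𝓕 _) (∑-+ 𝓕 _ _)) ⟩
      k * W + (∑ 𝓕 (λ F → ∑ V (λ x → ⟦ proper? F x ⟧)) + ∑ 𝓕 ∣_∣)
        ≡⟨ cong₂ (λ s t → k * W + (s + t)) (∑-swap 𝓕 V _) (sym (∑-degree 𝓕)) ⟩
      k * W + (∑ V (λ x → ∑ 𝓕 (λ F → ⟦ proper? F x ⟧)) + Σa)
        ≤⟨ ℕ.+-monoʳ-≤ (k * W) (ℕ.+-monoˡ-≤ Σa (∑-mono′ V (∑-proper saturated))) ⟩
      k * W + (Σb + Σa)
        ∎
      where open ℕ.≤-Reasoning

    -- The terms Σb + Σa, from the surcharges and the diagonal, are exactly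
    -- the difference between the sum of a² and the sum of b².
    ∑-b²≤ : ∑ V (λ x → b x * b x) ≤ k * W
    ∑-b²≤ = ℕ.+-cancelʳ-≤ (Σb + Σa) _ _ (begin
      ∑ V (λ x → b x * b x) + (Σb + Σa)
        ≡⟨ trans (∑-+ V _ _) (cong (∑ V (λ x → b x * b x) +_) (∑-+ V b a)) ⟨
      ∑ V (λ x → b x * b x + (b x + a x))
        ≡⟨ ∑-cong V (λ x → a²≡b²+a+b (a x)) ⟨
      ∑ V (λ x → a x * a x)
        ≤⟨ ∑-degree²≤ ⟩
      k * W + (Σb + Σa)
        ∎)
      where open ℕ.≤-Reasoning

    ∑V-const : ∀ c → ∑ V (λ _ → c) ≡ n * c
    ∑V-const c = trans (∑-const V c) (cong (_* c) (length-tabulate {n = n} (λ x → x)))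

    k*Σb≤ : k * Σb ≤ k * W + n * q
    k*Σb≤ = begin
      k * Σb                              ≡⟨ ∑-*ˡ k V b ⟨
      ∑ V (λ x → k * b x)                 ≤⟨ ∑-mono′ V (λ x → k*b≤b²+⌊k²/4⌋ k (b x)) ⟩
      ∑ V (λ x → b x * b x + q)           ≡⟨ ∑-+ V _ _ ⟩
      ∑ V (λ x → b x * b x) + ∑ V (λ _ → q)  ≤⟨ ℕ.+-mono-≤ ∑-b²≤ (ℕ.≤-reflexive (∑V-const q)) ⟩
      k * W + n * q                       ∎
      where open ℕ.≤-Reasoning

    Σa≤Σb+n : Σa ≤ Σb + n
    Σa≤Σb+n = begin
      Σa                                  ≤⟨ ∑-mono′ V (λ x → ℕ.m≤n+m∸n (a x) 1) ⟩
      ∑ V (λ x → 1 + b x)                 ≡⟨ ∑-+ V _ _ ⟩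
      ∑ V (λ _ → 1) + Σb                  ≡⟨ cong (_+ Σb) (trans (∑V-const 1) (ℕ.*-identityʳ n)) ⟩
      n + Σb                              ≡⟨ ℕ.+-comm n Σb ⟩
      Σb + n                              ∎
      where open ℕ.≤-Reasoning

    saturated-bound : k * length 𝓕 ≤ n * q + k * (n + 1)
    saturated-bound = ℕ.+-cancelˡ-≤ (k * W) _ _ (begin
      k * W + k * length 𝓕                ≡⟨ ℕ.*-distribˡ-+ k W (length 𝓕) ⟨
      k * (W + length 𝓕)                  ≤⟨ ℕ.*-monoʳ-≤ k (∑-size (proj₁ fisher)) ⟩
      k * (∑ 𝓕 ∣_∣ + 1)                   ≡⟨ cong (λ s → k * (s + 1)) (∑-degree 𝓕) ⟨
      k * (Σa + 1)                        ≤⟨ ℕ.*-monoʳ-≤ k (ℕ.+-monoˡ-≤ 1 Σa≤Σb+n) ⟩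
      k * (Σb + n + 1)                    ≡⟨ cong (k *_) (ℕ.+-assoc Σb n 1) ⟩
      k * (Σb + (n + 1))                  ≡⟨ ℕ.*-distribˡ-+ k Σb (n + 1) ⟩
      k * Σb + k * (n + 1)                ≤⟨ ℕ.+-monoˡ-≤ _ k*Σb≤ ⟩
      k * W + n * q + k * (n + 1)         ≡⟨ ℕ.+-assoc (k * W) (n * q) _ ⟩
      k * W + (n * q + k * (n + 1))       ∎)
      where open ℕ.≤-Reasoning

  k*f≤ : ∀ n k → k * f n k 0 ≤ n * ((k ^ 2) div 4) + k * (n + 1)
  k*f≤ n k
    with 𝓕 , fisher , len ← f-attained n k 0
    with 𝓖 , 𝓖-fisher , len′ , saturated ← saturate 𝓕 fisher
    = subst (λ m → k * m ≤ n * ((k ^ 2) div 4) + k * (n + 1)) (trans len′ len)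
            (saturated-bound 𝓖-fisher saturated)

  -- Unnormalised fractions with denominator suc d

  */1 : ∀ a b d → mkℚᵘ (ℤ.+ a) d ℚᵘ.* mkℚᵘ (ℤ.+ b) 0 ℚᵘ.≃ mkℚᵘ (ℤ.+ (a * b)) d
  */1 a b d = ℚᵘ.*≡* (cong₂ ℤ._*_ (sym (ℤ.pos-* a b)) (cong ℤ.+_ (sym (ℕ.*-identityʳ (suc d)))))

  +/1 : ∀ a b d → mkℚᵘ (ℤ.+ a) d ℚᵘ.+ mkℚᵘ (ℤ.+ b) 0 ℚᵘ.≃ mkℚᵘ (ℤ.+ (a + b * suc d)) d
  +/1 a b d = ℚᵘ.*≡* (cong₂ ℤ._*_
    (cong₂ ℤ._+_ (ℤ.*-identityʳ (ℤ.+ a)) (sym (ℤ.pos-* b (suc d))))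
    (cong ℤ.+_ (sym (ℕ.*-identityʳ (suc d)))))

  /1≤ : ∀ m a d → suc d * m ≤ a → mkℚᵘ (ℤ.+ m) 0 ℚᵘ.≤ mkℚᵘ (ℤ.+ a) d
  /1≤ m a d d*m≤a = ℚᵘ.*≤* (subst₂ ℤ._≤_ (ℤ.pos-* m (suc d)) (sym (ℤ.*-identityʳ (ℤ.+ a)))
    (ℤ.+≤+ (ℕ.≤-trans (ℕ.≤-reflexive (ℕ.*-comm m (suc d))) d*m≤a)))

  bound-as-fraction : ∀ n q d → n * q + suc d * (n + 1) ≡ n * q + n * suc d + 1 * suc d
  bound-as-fraction = solve-∀

-- The bound in the rationals

open import Data.Integer using (+_)
open import Data.Rational using (toℚᵘ; _/_; _+_; _*_; _≤_; 1ℚ)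

open Counting using (k*f≤; */1; +/1; /1≤; bound-as-fraction)

theorem1p4 : (n k : ℕ) .{{_ : NonZero n}} .{{_ : NonZero k}} →
    (+ f n k 0) / 1 ≤ ((+ n) / k) * ((+ ((k ^ 2) div 4)) / 1) + (+ n) / 1 + 1ℚ
theorem1p4 n k@(suc d) = ℚ.toℚᵘ-cancel-≤ (begin
  toℚᵘ (+ f n k 0 / 1)                                        ≃⟨ ℚ.toℚᵘ-fromℚᵘ (mkℚᵘ (+ f n k 0) 0) ⟩
  mkℚᵘ (+ f n k 0) 0                                          ≤⟨ /1≤ (f n k 0) _ d (subst (k ℕ* f n k 0 ℕ≤_) (bound-as-fraction n q d) (k*f≤ n k)) ⟩
  mkℚᵘ (+ (n ℕ* q ℕ+ n ℕ* k ℕ+ 1 ℕ* k)) d                     ≃⟨ +/1 (n ℕ* q ℕ+ n ℕ* k) 1 d ⟨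
  mkℚᵘ (+ (n ℕ* q ℕ+ n ℕ* k)) d ℚᵘ.+ 1ℚᵘ                      ≃⟨ ℚᵘ.+-congˡ 1ℚᵘ (+/1 (n ℕ* q) n d) ⟨
  mkℚᵘ (+ (n ℕ* q)) d ℚᵘ.+ mkℚᵘ (+ n) 0 ℚᵘ.+ 1ℚᵘ              ≃⟨ ℚᵘ.+-congˡ 1ℚᵘ (ℚᵘ.+-congˡ (mkℚᵘ (+ n) 0) (*/1 n q d)) ⟨
  mkℚᵘ (+ n) d ℚᵘ.* mkℚᵘ (+ q) 0 ℚᵘ.+ mkℚᵘ (+ n) 0 ℚᵘ.+ 1ℚᵘ   ≃⟨ ℚᵘ.+-congˡ 1ℚᵘ (ℚᵘ.+-cong
                                                                   (ℚᵘ.*-cong (ℚ.toℚᵘ-fromℚᵘ (mkℚᵘ (+ n) d)) (ℚ.toℚᵘ-fromℚᵘ (mkℚᵘ (+ q) 0)))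
                                                                   (ℚ.toℚᵘ-fromℚᵘ (mkℚᵘ (+ n) 0))) ⟨
  toℚᵘ (+ n / k) ℚᵘ.* toℚᵘ (+ q / 1) ℚᵘ.+ toℚᵘ (+ n / 1) ℚᵘ.+ 1ℚᵘ
                                                              ≃⟨ ℚᵘ.+-congˡ 1ℚᵘ (ℚᵘ.+-congˡ (toℚᵘ (+ n / 1)) (ℚ.toℚᵘ-homo-* (+ n / k) (+ q / 1))) ⟨
  toℚᵘ (+ n / k * (+ q / 1)) ℚᵘ.+ toℚᵘ (+ n / 1) ℚᵘ.+ 1ℚᵘ     ≃⟨ ℚᵘ.+-congˡ 1ℚᵘ (ℚ.toℚᵘ-homo-+ (+ n / k * (+ q / 1)) (+ n / 1)) ⟨
  toℚᵘ (+ n / k * (+ q / 1) + + n / 1) ℚᵘ.+ 1ℚᵘ               ≃⟨ ℚ.toℚᵘ-homo-+ (+ n / k * (+ q / 1) + + n / 1) 1ℚ ⟨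
  toℚᵘ (+ n / k * (+ q / 1) + + n / 1 + 1ℚ)                   ∎)
  where
  open ℚᵘ.≤-Reasoning
  open Data.Nat using () renaming (_+_ to infixl 6 _ℕ+_; _*_ to infixl 7 _ℕ*_; _≤_ to infix 4 _ℕ≤_)
  q = (k ^ 2) div 4
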